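{- Let $q$ be a prime power, $m,n$ positive integers with $2\le n\le m$, and let $\mathcal{C}\subseteq\mathbb{F}_q^{m\times n}$ be a nonzero $\mathbb{F}_q$-linear code with minimum rank distance $d$. Then 1. $\mathcal{W}^{\mathcal{P}}_{\mathcal{C}}(T)=q^dT\,\mathcal{W}_{\mathcal{C}}(qT)+\mathcal{W}_{\mathcal{C}}(T)-(q^m-1)^{ -1}W_n(\mathcal{C})\,q^n\,T^{n-d+1}$; 2. $\mathcal{W}^{\mathcal{S}}_{\mathcal{C}}(T)=\mathcal{W}_{\mathcal{C}}(T)-(q^m-1)^{ -1}W_n(\mathcal{C})\,T^{n-d}$.
   Context: $W_t(\mathcal{C})$ is the number of elements of $\mathcal{C}$ of rank $t$, $W_{\mathcal{C}}(x,y)=\sum_{t=0}^nW_t(\mathcal{C})x^{n-t}y^t$; $d$ is the minimum rank of a nonzero element. Gaussian binomials $\begin{bmatrix} N\\ r\end{bmatrix}$ count $r$-dimensional subspaces of $\mathbb{F}_q^N$. The normalized weight enumerator is $\mathcal{W}_{\mathcal{C}}(T)=(q^m-1)^{ -1}\sum_{i=d}^n\begin{bmatrix} n\\ i\end{bmatrix}^{ -1}W_i(\mathcal{C})T^{i-d}$. For $f(x,y)=\sum_{i=0}^nf_ix^{n-i}y^i$ homogeneous of degree $n$ define the $q$-derivatives $D_x f=\sum_i f_i\begin{bmatrix} n-i\\ 1\end{bmatrix}x^{n-i-1}y^i$, $D_yf=\sum_if_i\begin{bmatrix} i\\ 1\end{bmatrix}x^{n-i}y^{i-1}$, $D_{q,x}f=\sum_if_iq^i\begin{bmatrix}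 n-i\\ 1\end{bmatrix}x^{n-i-1}y^i$, and the puncturing and shortening operators $\mathcal{P}=\begin{bmatrix} n\\ 1\end{bmatrix}^{ -1}(D_{q,x}+D_y)$, $\mathcal{S}=\begin{bmatrix} n\\ 1\end{bmatrix}^{ -1}D_x$. Write $\mathcal{P}(W_{\mathcal{C}})-x^{n-1}=\sum_{i}c_ix^{n-1-i}y^i$ and $\mathcal{S}(W_{\mathcal{C}})-x^{n-1}=\sum_ic'_ix^{n-1-i}y^i$. Then $\mathcal{W}^{\mathcal{P}}_{\mathcal{C}}(T)=(q^m-1)^{ -1}\sum_{i=d-1}^{n-1}\begin{bmatrix} n-1\\ i\end{bmatrix}^{ -1}c_iT^{i-d+1}$ (normalization of $\mathcal{P}(W_{\mathcal{C}})$ with length $n-1$ and distance $d-1$) and $\mathcal{W}^{\mathcal{S}}_{\mathcal{C}}(T)=(q^m-1)^{ -1}\sum_{i=d}^{n-1}\begin{bmatrix} n-1\\ i\end{bmatrix}^{ -1}c'_iT^{i-d}$ (normalization of $\mathcal{S}(W_{\mathcal{C}})$ with length $n-1$ and distance $d$). -}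

module Defs where

open import Level using (0ℓ)
open import Algebra.Bundles using (CommutativeRing)
open import Function.Bundles using (Inverse)
open import Data.Fin as Fin using (Fin)
open import Data.Nat as ℕ using (ℕ; zero; suc; _∸_; _≤_; _≤ᵇ_; _≡ᵇ_)
open import Data.Bool using (Bool; true; false; if_then_else_; _∧_; _∨_; not)
open import Data.List as List using (List; []; _∷_; _++_)
open import Data.Vec.Functional as VF using (Vector)
open import Data.Product using (Σ; ∃; _×_; _,_)
open import Relation.Nullary using (¬_; Dec)
open import Relation.Nullary.Decidable using (⌊_⌋)
open import Relation.Binary.PropositionalEquality as ≡ using (_≡_)
open import Data.Rational as ℚ using (ℚ)
open import Data.Integer as ℤ using (ℤ)

-- A field is a commutative ring with 1 ≠ 0 in which every nonzero element
-- is invertible; it has exactly q elements when its setoid is in bijection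
-- with Fin q.  (The existence of such a field forces q to be a prime power.)

record FiniteField (q : ℕ) : Set₁ where
  field
    commRing : CommutativeRing 0ℓ 0ℓ
  open CommutativeRing commRing public
  field
    1≉0  : ¬ (1# ≈ 0#)
    inv  : ∀ x → ¬ (x ≈ 0#) → ∃ λ y → (x * y) ≈ 1#
    card : Inverse setoid (≡.setoid (Fin q))

-- Gaussian binomial [N r]_q (number of r-dim subspaces of F_q^N),
-- via the q-Pascal recursion [N+1, r+1] = [N, r] + q^(r+1) [N, r+1].

gauss : ℕ → ℕ → ℕ → ℕ
gauss q N       zero    = 1
gauss q zero    (suc r) = 0
gauss q (suc N) (suc r) = gauss q N r ℕ.+ q ℕ.^ suc r ℕ.* gauss q N (suc r)

ℕ→ℚ : ℕ → ℚ
ℕ→ℚ k = ℤ.+ k ℚ./ 1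

-- x ÷ℕ k = x / k  (only ever used with k ≠ 0; by convention x ÷ℕ 0 = 0)
_÷ℕ_ : ℚ → ℕ → ℚ
x ÷ℕ zero    = ℚ.0ℚ
x ÷ℕ (suc k) = x ℚ.* (ℤ.+ 1 ℚ./ suc k)

-- Polynomials in one variable T, as coefficient sequences (coeff of T^k).
Poly : Set
Poly = ℕ → ℚ

Tmul : Poly → Poly
Tmul p zero    = ℚ.0ℚ
Tmul p (suc k) = p k

-- p(a T), for a natural number a
atScaled : ℕ → Poly → Poly
atScaled a p k = ℕ→ℚ (a ℕ.^ k) ℚ.* p k

scalePoly : ℚ → Poly → Poly
scalePoly c p k = c ℚ.* p k

monomial : ℚ → ℕ → Poly
monomial c e k = if k ≡ᵇ e then c else ℚ.0ℚ

_⊕_ : Poly → Poly → Poly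
(p ⊕ r) k = p k ℚ.+ r k

_⊖_ : Poly → Poly → Poly
(p ⊖ r) k = p k ℚ.- r k

-- Homogeneous polynomials f(x,y) = Σ_i f_i x^(N-i) y^i of degree N,
-- represented by the coefficient sequence i ↦ f_i (only i ≤ N matters).

HPoly : Set
HPoly = ℕ → ℚ

module QDeriv (q : ℕ) where

  br : ℕ → ℚ
  br k = ℕ→ℚ (gauss q k 1)

  -- the arguments N are the degree of the input polynomial
  D-x : ℕ → HPoly → HPoly
  D-x N f i = f i ℚ.* br (N ∸ i)

  D-y : ℕ → HPoly → HPoly
  D-y N f i = f (suc i) ℚ.* br (suc i)

  D-qx : ℕ → HPoly → HPoly
  D-qx N f i = (f i ℚ.* ℕ→ℚ (q ℕ.^ i)) ℚ.* br (N ∸ i)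

  𝒫 : ℕ → HPoly → HPoly
  𝒫 N f i = (D-qx N f i ℚ.+ D-y N f i) ÷ℕ gauss q N 1

  𝒮 : ℕ → HPoly → HPoly
  𝒮 N f i = D-x N f i ÷ℕ gauss q N 1

  minusXpow : HPoly → HPoly
  minusXpow f i = if i ≡ᵇ 0 then f i ℚ.- ℚ.1ℚ else f i

  -- normalization with length N, distance δ, and factor (q^m - 1)^{-1}:
  --   (q^m-1)^{-1} Σ_{i=δ}^{N} [N i]^{-1} g_i T^{i-δ}
  normalize : (m N δ : ℕ) → HPoly → Poly
  normalize m N δ g k =
    if (δ ℕ.+ k) ≤ᵇ N
    then (g (δ ℕ.+ k) ÷ℕ gauss q N (δ ℕ.+ k)) ÷ℕ (q ℕ.^ m ∸ 1)
    else ℚ.0ℚ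

module _ {q : ℕ} (F : FiniteField q) where
  open FiniteField F
  private
    module Card = Inverse card

  Mat : ℕ → ℕ → Set
  Mat m n = Fin m → Fin n → Carrier

  _≈M_ : ∀ {m n} → Mat m n → Mat m n → Set
  A ≈M B = ∀ i j → A i j ≈ B i j

  0M : ∀ {m n} → Mat m n
  0M i j = 0#

  _+M_ : ∀ {m n} → Mat m n → Mat m n → Mat m n
  (A +M B) i j = A i j + B i j

  _·M_ : ∀ {m n} → Carrier → Mat m n → Mat m n
  (a ·M A) i j = a * A i j

  _==_ : Carrier → Carrier → Bool
  x == y = ⌊ Card.to x Fin.≟ Card.to y ⌋

  elements : List Carrier
  elements = List.map Card.from (List.allFin q)

  allFuns : ∀ {A : Set} (k : ℕ) → List A → List (Fin k → A)
  allFuns zero    xs = (λ ()) ∷ []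
  allFuns (suc k) xs =
    List.concatMap (λ x → List.map (λ f → x VF.∷ f) (allFuns k xs)) xs

  -- all m × n matrices (one representative of each)
  allMats : (m n : ℕ) → List (Mat m n)
  allMats m n = allFuns m (allFuns n elements)

  allB : ∀ {A : Set} → (A → Bool) → List A → Bool
  allB p xs = List.foldr (λ x b → p x ∧ b) true xs

  sumF : (k : ℕ) → (Fin k → Carrier) → Carrier
  sumF zero    v = 0#
  sumF (suc k) v = v Fin.zero + sumF k (λ i → v (Fin.suc i))

  isZeroVec : ∀ {k} → (Fin k → Carrier) → Bool
  isZeroVec {k} v = allB (λ i → v i == 0#) (List.allFin k)

  lincomb : ∀ {k m} → (Fin k → Carrier) → (Fin k → Fin m → Carrier) → Fin m → Carrier
  lincomb {k} a v i = sumF k (λ j → a j * v j i)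

  independentᵇ : ∀ {k m} → (Fin k → Fin m → Carrier) → Bool
  independentᵇ {k} v =
    allB (λ a → not (isZeroVec (lincomb a v)) ∨ isZeroVec a) (allFuns k elements)

  sublists : ∀ {A : Set} → List A → List (List A)
  sublists []       = [] ∷ []
  sublists (x ∷ xs) = sublists xs ++ List.map (x ∷_) (sublists xs)

  rank : ∀ {m n} → Mat m n → ℕ
  rank {m} {n} M =
    List.foldr
      (λ S r → if independentᵇ (λ j i → M i (List.lookup S j))
               then ℕ._⊔_ (List.length S) r else r)
      0 (sublists (List.allFin n))

  record IsLinearCode {m n : ℕ} (C : Mat m n → Set) : Set where
    field
      respects : ∀ {A B} → A ≈M B → C A → C B
      zero∈    : C 0M
      +-closed : ∀ {A B} → C A → C B → C (A +M B)
      ·-closed : ∀ a {A} → C A → C (a ·M A)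

  -- d is the minimum rank of a nonzero codeword (in particular C ≠ 0)
  IsMinRankDistance : ∀ {m n} → (Mat m n → Set) → ℕ → Set
  IsMinRankDistance C d =
    (∃ λ M → C M × ¬ (M ≈M 0M) × rank M ≡ d)
    × (∀ M → C M → ¬ (M ≈M 0M) → d ≤ rank M)

  W : ∀ {m n} {C : Mat m n → Set} → (∀ M → Dec (C M)) → ℕ → ℕ
  W {m} {n} C? t =
    List.length (List.filterᵇ (λ M → ⌊ C? M ⌋ ∧ (rank M ≡ᵇ t)) (allMats m n))

  -- coefficient sequence of W_C(x,y) = Σ_t W_t(C) x^(n-t) y^t
  WC : ∀ {m n} {C : Mat m n → Set} → (∀ M → Dec (C M)) → HPoly
  WC C? t = ℕ→ℚ (W C? t)

  open QDeriv q

  𝒲 : ∀ {m n} {C : Mat m n → Set} → (∀ M → Dec (C M)) → ℕ → Poly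
  𝒲 {m} {n} C? d = normalize m n d (WC C?)

  𝒲ᴾ : ∀ {m n} {C : Mat m n → Set} → (∀ M → Dec (C M)) → ℕ → Poly
  𝒲ᴾ {m} {n} C? d = normalize m (n ∸ 1) (d ∸ 1) (minusXpow (𝒫 n (WC C?)))

  𝒲ˢ : ∀ {m n} {C : Mat m n → Set} → (∀ M → Dec (C M)) → ℕ → Poly
  𝒲ˢ {m} {n} C? d = normalize m (n ∸ 1) d (minusXpow (𝒮 n (WC C?)))

-- On coefficients, 𝒮 multiplies W_i by [n−i]/[n], and 𝒫 produces q^i [n−i]/[n] W_i + [i+1]/[n] W_{i+1}.
-- Dividing by [n−1 i] and using the absorption identities [n i] [n−i] = [n] [n−1 i] = [n i+1] [i+1]
-- (clear the q-factorials in [a+b a] [a]! [b]! = [a+b]!) gives W_i/[n i], resp. q^i W_i/[n i] + W_{i+1}/[n i+1],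
-- which are the coefficients of the right-hand sides.  The corrections sit at the top index i = n, which
-- does not exist in length n−1, and, for puncturing, at the bottom: W_0 = 1 is cancelled by the subtracted
-- x^(n−1), and W_i = 0 for 0 < i < d.

module Submission where

open import Defs
open import Data.Nat as ℕ using (ℕ; zero; suc; _≤_; _<_; _∸_; _^_; _+_; _*_; z≤n; s≤s; NonZero)
import Data.Nat.Properties as ℕ
open import Data.Nat.Tactic.RingSolver using (solve-∀)
open import Data.Product using (_,_; _×_; ∃; proj₁; proj₂)
open import Data.Sum using (inj₁; inj₂)
open import Function.Bundles using (Inverse; Equivalence)
open import Data.List.Membership.Propositional using (_∈_)
open import Data.List.Membership.Propositional.Properties using (∈-map⁺; ∈-++⁺ˡ; ∈-++⁺ʳ; ∈-allFin; ∈-concatMap⁺)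
open import Data.List.Relation.Unary.Any using (here; there)
import Data.List.Relation.Unary.Any as Any
import Data.List.Relation.Unary.All.Properties as All
open import Data.Bool using (Bool; true; false; if_then_else_; T; _∧_; _∨_; not)
import Data.Bool.Properties as Bool
open import Data.Empty using (⊥-elim)
open import Relation.Nullary using (¬_; Dec; yes; no)
open import Relation.Nullary.Decidable using (T?; ⌊_⌋; ⌊⌋-map′; toWitness; fromWitness; decidable-stable; map′)
open import Data.List as List using (List; []; _∷_; _++_; length; filterᵇ)
import Data.List.Properties as List
open import Data.List.Relation.Unary.All as All using (All; []; _∷_)
open import Data.Fin as Fin using (Fin)
import Data.Fin.Properties as Fin
import Data.Vec.Functional as VF
import Relation.Binary.Reasoning.Setoid as SetoidReasoning
open import Relation.Binary.Definitions using (tri<; tri≈; tri>)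
import Data.Integer as ℤ
import Data.Integer.Properties as ℤ
open import Data.Rational as ℚ using (ℚ; mkℚ; 0ℚ; 1ℚ)
import Data.Rational.Properties as ℚ
open import Data.Nat.Coprimality using (1-coprimeTo) renaming (sym to coprime-sym)
open import Relation.Binary.PropositionalEquality
open import Function using (_∘_)

cong₃ : ∀ {A B C D : Set} (f : A → B → C → D) {a a′ b b′ c c′} →
        a ≡ a′ → b ≡ b′ → c ≡ c′ → f a b c ≡ f a′ b′ c′
cong₃ f refl refl refl = refl

if-T : ∀ {A : Set} {b} {x y : A} → T b → (if b then x else y) ≡ x
if-T {b = true} _ = refl

if-¬T : ∀ {A : Set} {b} {x y : A} → ¬ T b → (if b then x else y) ≡ y
if-¬T {b = true}  ¬t = ⊥-elim (¬t _)
if-¬T {b = false} _  = refl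

T-not⇒¬T : ∀ {b} → T (not b) → ¬ T b
T-not⇒¬T {true} ()

¬T⇒T-not : ∀ {b} → ¬ T b → T (not b)
¬T⇒T-not {true}  ¬t = ¬t _
¬T⇒T-not {false} _  = _

-- Gaussian binomial coefficients

module _ (q : ℕ) where

  qInt : ℕ → ℕ
  qInt k = gauss q k 1

  qInt-suc : ∀ k → qInt (suc k) ≡ 1 + q * qInt k
  qInt-suc k = cong (λ z → 1 + z * qInt k) (ℕ.*-identityʳ q)

  qInt-+ : ∀ a b → qInt a + q ^ a * qInt b ≡ qInt (a + b)
  qInt-+ zero    b = ℕ.+-identityʳ (qInt b)
  qInt-+ (suc a) b = begin
      qInt (suc a) + q ^ suc a * qInt b
    ≡⟨ cong (_+ q ^ suc a * qInt b) (qInt-suc a) ⟩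
      1 + q * qInt a + q * q ^ a * qInt b
    ≡⟨ factor-q (qInt a) q (q ^ a) (qInt b) ⟩
      1 + q * (qInt a + q ^ a * qInt b)
    ≡⟨ cong (λ z → 1 + q * z) (qInt-+ a b) ⟩
      1 + q * qInt (a + b)
    ≡⟨ qInt-suc (a + b) ⟨
      qInt (suc a + b) ∎
    where
      open ≡-Reasoning
      factor-q : ∀ x y z w → 1 + y * x + y * z * w ≡ 1 + y * (x + z * w)
      factor-q = solve-∀

  qInt-suc-nonZero : ∀ k → NonZero (qInt (suc k))
  qInt-suc-nonZero k = ℕ.≢-nonZero (λ eq → ℕ.0≢1+n (trans (sym eq) (qInt-suc k)))

  qFactorial : ℕ → ℕ
  qFactorial zero    = 1
  qFactorial (suc k) = qInt (suc k) * qFactorial k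

  qFactorial-nonZero : ∀ k → NonZero (qFactorial k)
  qFactorial-nonZero zero    = _
  qFactorial-nonZero (suc k) = ℕ.m*n≢0 (qInt (suc k)) (qFactorial k) {{qInt-suc-nonZero k}} {{qFactorial-nonZero k}}

  gauss-<⇒≡0 : ∀ {N r} → N < r → gauss q N r ≡ 0
  gauss-<⇒≡0 {zero}  {suc r} _ = refl
  gauss-<⇒≡0 {suc N} {suc r} (s≤s N<r)
    rewrite gauss-<⇒≡0 N<r | gauss-<⇒≡0 (ℕ.m<n⇒m<1+n N<r) = ℕ.*-zeroʳ (q ^ suc r)

  gauss-N-N≡1 : ∀ N → gauss q N N ≡ 1
  gauss-N-N≡1 zero = refl
  gauss-N-N≡1 (suc N)
    rewrite gauss-N-N≡1 N | gauss-<⇒≡0 (ℕ.n<1+n N) = cong suc (ℕ.*-zeroʳ (q ^ suc N))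

  gauss-qFactorial : ∀ a b → gauss q (a + b) a * (qFactorial a * qFactorial b) ≡ qFactorial (a + b)
  gauss-qFactorial zero    b = trans (ℕ.+-identityʳ _) (ℕ.+-identityʳ (qFactorial b))
  gauss-qFactorial (suc a) zero
    rewrite ℕ.+-identityʳ a | gauss-N-N≡1 a | gauss-<⇒≡0 (ℕ.n<1+n a) | ℕ.*-zeroʳ (q ^ suc a)
    = trans (ℕ.+-identityʳ _) (ℕ.*-identityʳ _)
  gauss-qFactorial (suc a) (suc b) = begin
      (G₁ + q ^ suc a * G₂) * ([ suc a ]! * [ suc b ]!)
    ≡⟨ expand G₁ (q ^ suc a) G₂ (qInt (suc a)) [ a ]! (qInt (suc b)) [ b ]! ⟩
      qInt (suc a) * (G₁ * ([ a ]! * [ suc b ]!))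
        + q ^ suc a * qInt (suc b) * (G₂ * ([ suc a ]! * [ b ]!))
    ≡⟨ cong₂ (λ u v → qInt (suc a) * u + q ^ suc a * qInt (suc b) * v)
             (gauss-qFactorial a (suc b)) shifted ⟩
      qInt (suc a) * [ a + suc b ]! + q ^ suc a * qInt (suc b) * [ a + suc b ]!
    ≡⟨ ℕ.*-distribʳ-+ [ a + suc b ]! (qInt (suc a)) _ ⟨
      (qInt (suc a) + q ^ suc a * qInt (suc b)) * [ a + suc b ]!
    ≡⟨ cong (_* [ a + suc b ]!) (qInt-+ (suc a) (suc b)) ⟩
      [ suc a + suc b ]! ∎
    where
      open ≡-Reasoning
      [_]! = qFactorial
      G₁ = gauss q (a + suc b) a
      G₂ = gauss q (a + suc b) (suc a)
      expand : ∀ g₁ Q g₂ sa fa sb fb →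
        (g₁ + Q * g₂) * (sa * fa * (sb * fb))
          ≡ sa * (g₁ * (fa * (sb * fb))) + Q * sb * (g₂ * (sa * fa * fb))
      expand = solve-∀
      shifted : G₂ * ([ suc a ]! * [ b ]!) ≡ [ a + suc b ]!
      shifted rewrite ℕ.+-suc a b = gauss-qFactorial (suc a) b

  gauss-nonZero : ∀ {N i} → i ≤ N → NonZero (gauss q N i)
  gauss-nonZero {i = i} i≤N with ℕ.m≤n⇒∃[o]m+o≡n i≤N
  ... | b , refl = ℕ.≢-nonZero λ eq →
    ℕ.≢-nonZero⁻¹ (qFactorial (i + b)) {{qFactorial-nonZero (i + b)}} (trans (sym (gauss-qFactorial i b)) (cong (_* (qFactorial i * qFactorial b)) eq))

  private
    cancel-qFactorials : ∀ a b x y →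
      x * (qFactorial a * qFactorial b) ≡ y * (qFactorial a * qFactorial b) → x ≡ y
    cancel-qFactorials a b x y = ℕ.*-cancelʳ-≡ x y _
      {{ℕ.m*n≢0 (qFactorial a) (qFactorial b) {{qFactorial-nonZero a}} {{qFactorial-nonZero b}}}}

  gauss-absorbʳ : ∀ {N i} → i ≤ N → gauss q (suc N) i * qInt (suc N ∸ i) ≡ qInt (suc N) * gauss q N i
  gauss-absorbʳ {i = i} i≤N with ℕ.m≤n⇒∃[o]m+o≡n i≤N
  ... | b , refl rewrite ℕ.+-∸-assoc 1 (ℕ.m≤m+n i b) | ℕ.m+n∸m≡n i b =
    cancel-qFactorials i b _ (qInt (suc (i + b)) * gauss q (i + b) i) (begin
      gauss q (suc (i + b)) i * qInt (suc b) * ([ i ]! * [ b ]!)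
    ≡⟨ regroup (gauss q (suc (i + b)) i) (qInt (suc b)) [ i ]! [ b ]! ⟩
      gauss q (suc (i + b)) i * ([ i ]! * [ suc b ]!)
    ≡⟨ cong (λ z → gauss q z i * ([ i ]! * [ suc b ]!)) (ℕ.+-suc i b) ⟨
      gauss q (i + suc b) i * ([ i ]! * [ suc b ]!)
    ≡⟨ gauss-qFactorial i (suc b) ⟩
      [ i + suc b ]!
    ≡⟨ cong [_]! (ℕ.+-suc i b) ⟩
      qInt (suc (i + b)) * [ i + b ]!
    ≡⟨ cong (qInt (suc (i + b)) *_) (gauss-qFactorial i b) ⟨
      qInt (suc (i + b)) * (gauss q (i + b) i * ([ i ]! * [ b ]!))
    ≡⟨ ℕ.*-assoc (qInt (suc (i + b))) (gauss q (i + b) i) ([ i ]! * [ b ]!) ⟨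
      qInt (suc (i + b)) * gauss q (i + b) i * ([ i ]! * [ b ]!) ∎)
    where
      open ≡-Reasoning
      [_]! = qFactorial
      regroup : ∀ g s f₁ f₂ → g * s * (f₁ * f₂) ≡ g * (f₁ * (s * f₂))
      regroup = solve-∀

  gauss-absorbˡ : ∀ {N i} → i ≤ N → gauss q (suc N) (suc i) * qInt (suc i) ≡ qInt (suc N) * gauss q N i
  gauss-absorbˡ {i = i} i≤N with ℕ.m≤n⇒∃[o]m+o≡n i≤N
  ... | b , refl = cancel-qFactorials i b _ (qInt (suc (i + b)) * gauss q (i + b) i) (begin
      gauss q (suc i + b) (suc i) * qInt (suc i) * ([ i ]! * [ b ]!)
    ≡⟨ regroup (gauss q (suc i + b) (suc i)) (qInt (suc i)) [ i ]! [ b ]! ⟩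
      gauss q (suc i + b) (suc i) * ([ suc i ]! * [ b ]!)
    ≡⟨ gauss-qFactorial (suc i) b ⟩
      qInt (suc (i + b)) * [ i + b ]!
    ≡⟨ cong (qInt (suc (i + b)) *_) (gauss-qFactorial i b) ⟨
      qInt (suc (i + b)) * (gauss q (i + b) i * ([ i ]! * [ b ]!))
    ≡⟨ ℕ.*-assoc (qInt (suc (i + b))) (gauss q (i + b) i) ([ i ]! * [ b ]!) ⟨
      qInt (suc (i + b)) * gauss q (i + b) i * ([ i ]! * [ b ]!) ∎)
    where
      open ≡-Reasoning
      [_]! = qFactorial
      regroup : ∀ g s f₁ f₂ → g * s * (f₁ * f₂) ≡ g * (s * f₁ * f₂)
      regroup = solve-∀

-- Division by natural numbers in ℚ

ℕ→ℚ-mkℚ : ∀ k → ℕ→ℚ k ≡ mkℚ (ℤ.+ k) 0 (coprime-sym (1-coprimeTo k))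
ℕ→ℚ-mkℚ k = ℚ.normalize-coprime (coprime-sym (1-coprimeTo k))

ℕ→ℚ-* : ∀ a b → ℕ→ℚ (a * b) ≡ ℕ→ℚ a ℚ.* ℕ→ℚ b
ℕ→ℚ-* a b rewrite ℕ→ℚ-mkℚ a | ℕ→ℚ-mkℚ b =
  trans (ℕ→ℚ-mkℚ (a * b))
        (sym (trans (cong (ℚ._/ 1) (sym (ℤ.pos-* a b))) (ℕ→ℚ-mkℚ (a * b))))

ℕ→ℚ-^ : ∀ a b c → ℕ→ℚ (a ^ b) ℚ.* ℕ→ℚ (a ^ c) ≡ ℕ→ℚ (a ^ (b + c))
ℕ→ℚ-^ a b c = trans (sym (ℕ→ℚ-* (a ^ b) (a ^ c))) (cong ℕ→ℚ (sym (ℕ.^-distribˡ-+-* a b c)))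

ℕ→ℚ-inverseˡ : ∀ k → (ℤ.+ 1 ℚ./ suc k) ℚ.* ℕ→ℚ (suc k) ≡ 1ℚ
ℕ→ℚ-inverseˡ k rewrite ℕ→ℚ-mkℚ (suc k) | ℚ.normalize-coprime {1} {k} (1-coprimeTo (suc k)) =
  ℚ.*-inverseˡ (mkℚ (ℤ.+ suc k) 0 (coprime-sym (1-coprimeTo (suc k))))

÷ℕ-*-cancel : ∀ x k .{{_ : NonZero k}} → (x ÷ℕ k) ℚ.* ℕ→ℚ k ≡ x
÷ℕ-*-cancel x (suc k) = begin
    x ℚ.* 1/k ℚ.* ℕ→ℚ (suc k)   ≡⟨ ℚ.*-assoc x 1/k (ℕ→ℚ (suc k)) ⟩
    x ℚ.* (1/k ℚ.* ℕ→ℚ (suc k)) ≡⟨ cong (x ℚ.*_) (ℕ→ℚ-inverseˡ k) ⟩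
    x ℚ.* 1ℚ                    ≡⟨ ℚ.*-identityʳ x ⟩
    x                           ∎
  where
    open ≡-Reasoning
    1/k = ℤ.+ 1 ℚ./ suc k

÷ℕ-unique : ∀ {x y} k .{{_ : NonZero k}} → y ℚ.* ℕ→ℚ k ≡ x → x ÷ℕ k ≡ y
÷ℕ-unique {x} {y} (suc k) refl = begin
    (y ℚ.* K) ℚ.* 1/k   ≡⟨ ℚ.*-assoc y K 1/k ⟩
    y ℚ.* (K ℚ.* 1/k)   ≡⟨ cong (y ℚ.*_) (ℚ.*-comm K 1/k) ⟩
    y ℚ.* (1/k ℚ.* K)   ≡⟨ cong (y ℚ.*_) (ℕ→ℚ-inverseˡ k) ⟩
    y ℚ.* 1ℚ            ≡⟨ ℚ.*-identityʳ y ⟩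
    y                   ∎
  where
    open ≡-Reasoning
    K = ℕ→ℚ (suc k)
    1/k = ℤ.+ 1 ℚ./ suc k

÷ℕ-÷ℕ : ∀ x v w .{{_ : NonZero v}} .{{_ : NonZero w}} →
        (x ÷ℕ v) ÷ℕ w ≡ x ÷ℕ (v * w)
÷ℕ-÷ℕ x v w = sym (÷ℕ-unique (v * w) {{ℕ.m*n≢0 v w}} (begin
    z ℚ.* ℕ→ℚ (v * w)         ≡⟨ cong (z ℚ.*_) (trans (ℕ→ℚ-* v w) (ℚ.*-comm (ℕ→ℚ v) (ℕ→ℚ w))) ⟩
    z ℚ.* (ℕ→ℚ w ℚ.* ℕ→ℚ v)   ≡⟨ ℚ.*-assoc z (ℕ→ℚ w) (ℕ→ℚ v) ⟨
    z ℚ.* ℕ→ℚ w ℚ.* ℕ→ℚ v     ≡⟨ cong (ℚ._* ℕ→ℚ v) (÷ℕ-*-cancel (x ÷ℕ v) w) ⟩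
    (x ÷ℕ v) ℚ.* ℕ→ℚ v        ≡⟨ ÷ℕ-*-cancel x v ⟩
    x                         ∎))
  where
    open ≡-Reasoning
    z = (x ÷ℕ v) ÷ℕ w

*-÷ℕ-*-cancelʳ : ∀ x t u .{{_ : NonZero t}} .{{_ : NonZero u}} →
                 (x ℚ.* ℕ→ℚ u) ÷ℕ (t * u) ≡ x ÷ℕ t
*-÷ℕ-*-cancelʳ x t u = ÷ℕ-unique (t * u) {{ℕ.m*n≢0 t u}} (begin
    (x ÷ℕ t) ℚ.* ℕ→ℚ (t * u)         ≡⟨ cong ((x ÷ℕ t) ℚ.*_) (ℕ→ℚ-* t u) ⟩
    (x ÷ℕ t) ℚ.* (ℕ→ℚ t ℚ.* ℕ→ℚ u)   ≡⟨ ℚ.*-assoc (x ÷ℕ t) (ℕ→ℚ t) (ℕ→ℚ u) ⟨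
    (x ÷ℕ t) ℚ.* ℕ→ℚ t ℚ.* ℕ→ℚ u     ≡⟨ cong (ℚ._* ℕ→ℚ u) (÷ℕ-*-cancel x t) ⟩
    x ℚ.* ℕ→ℚ u                      ∎)
  where open ≡-Reasoning

÷ℕ-rescale : ∀ x t u v w .{{_ : NonZero v}} .{{_ : NonZero w}} →
             t * u ≡ v * w → ((x ℚ.* ℕ→ℚ u) ÷ℕ v) ÷ℕ w ≡ x ÷ℕ t
÷ℕ-rescale x t u v w tu≡vw = begin
    ((x ℚ.* ℕ→ℚ u) ÷ℕ v) ÷ℕ w  ≡⟨ ÷ℕ-÷ℕ (x ℚ.* ℕ→ℚ u) v w ⟩
    (x ℚ.* ℕ→ℚ u) ÷ℕ (v * w)   ≡⟨ cong ((x ℚ.* ℕ→ℚ u) ÷ℕ_) tu≡vw ⟨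
    (x ℚ.* ℕ→ℚ u) ÷ℕ (t * u)   ≡⟨ *-÷ℕ-*-cancelʳ x t u {{ℕ.m*n≢0⇒m≢0 t}} {{ℕ.m*n≢0⇒n≢0 t}} ⟩
    x ÷ℕ t                     ∎
  where
    open ≡-Reasoning
    instance
      tu-nonZero : NonZero (t * u)
      tu-nonZero = subst NonZero (sym tu≡vw) (ℕ.m*n≢0 v w)

0ℚ-÷ℕ : ∀ k → 0ℚ ÷ℕ k ≡ 0ℚ
0ℚ-÷ℕ zero    = refl
0ℚ-÷ℕ (suc k) = ℚ.*-zeroˡ (ℤ.+ 1 ℚ./ suc k)

÷ℕ-1 : ∀ x → x ÷ℕ 1 ≡ x
÷ℕ-1 = ℚ.*-identityʳ

÷ℕ-distrib-+ : ∀ k x y → (x ℚ.+ y) ÷ℕ k ≡ x ÷ℕ k ℚ.+ y ÷ℕ k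
÷ℕ-distrib-+ zero    x y = sym (ℚ.+-identityʳ 0ℚ)
÷ℕ-distrib-+ (suc k) x y = ℚ.*-distribʳ-+ (ℤ.+ 1 ℚ./ suc k) x y

÷ℕ-distrib-- : ∀ k x y → (x ℚ.- y) ÷ℕ k ≡ x ÷ℕ k ℚ.- y ÷ℕ k
÷ℕ-distrib-- zero    x y = refl
÷ℕ-distrib-- (suc k) x y = trans (÷ℕ-distrib-+ (suc k) x (ℚ.- y))
                                 (cong (x ÷ℕ suc k ℚ.+_) (sym (ℚ.neg-distribˡ-* y (ℤ.+ 1 ℚ./ suc k))))

*-÷ℕ-assoc : ∀ k a x → a ℚ.* (x ÷ℕ k) ≡ (a ℚ.* x) ÷ℕ k
*-÷ℕ-assoc zero    a x = ℚ.*-zeroʳ a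
*-÷ℕ-assoc (suc k) a x = sym (ℚ.*-assoc a x (ℤ.+ 1 ℚ./ suc k))

-- Normalized weight enumerators of 𝒫(f) and 𝒮(f)

monomial-≡ : ∀ c e → monomial c e e ≡ c
monomial-≡ c e = if-T (ℕ.≡⇒≡ᵇ e e refl)

monomial-≢ : ∀ c {e k} → k ≢ e → monomial c e k ≡ 0ℚ
monomial-≢ c {e} {k} k≢e = if-¬T (k≢e ∘ ℕ.≡ᵇ⇒≡ k e)

monomial-+ : ∀ x {d n} k → d ≤ n → monomial x n (d + k) ≡ monomial x (n ∸ d) k
monomial-+ x {d} {n} k d≤n with k ℕ.≟ n ∸ d
... | yes refl = begin
    monomial x n (d + (n ∸ d))  ≡⟨ cong (monomial x n) (ℕ.m+[n∸m]≡n d≤n) ⟩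
    monomial x n n              ≡⟨ monomial-≡ x n ⟩
    x                           ≡⟨ monomial-≡ x (n ∸ d) ⟨
    monomial x (n ∸ d) (n ∸ d)  ∎
  where open ≡-Reasoning
... | no k≢n∸d = trans (monomial-≢ x (λ d+k≡n → k≢n∸d (trans (sym (ℕ.m+n∸m≡n d k)) (cong (_∸ d) d+k≡n))))
                       (sym (monomial-≢ x k≢n∸d))

monomial-÷ℕ : ∀ x e k c → monomial x e k ÷ℕ c ≡ monomial (x ÷ℕ c) e k
monomial-÷ℕ x e k c = trans (Bool.if-float (_÷ℕ c) (k ℕ.≡ᵇ e)) (Bool.if-cong-else (k ℕ.≡ᵇ e) (0ℚ-÷ℕ c))

module Normalization (q : ℕ) where
  open QDeriv q

  -- The coefficient of T^(i−δ) in normalize m N δ g, without the factor (q^m−1)^{-1}; indexing by i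
  -- rather than i − δ lets normalizations with different δ be compared termwise.
  normalizedCoeff : ℕ → HPoly → ℕ → ℚ
  normalizedCoeff N g i = if i ℕ.≤ᵇ N then g i ÷ℕ gauss q N i else 0ℚ

  normalize≡normalizedCoeff : ∀ m N δ g k →
    normalize m N δ g k ≡ normalizedCoeff N g (δ + k) ÷ℕ (q ^ m ∸ 1)
  normalize≡normalizedCoeff m N δ g k =
    trans (Bool.if-cong-else ((δ + k) ℕ.≤ᵇ N) (sym (0ℚ-÷ℕ (q ^ m ∸ 1))))
          (sym (Bool.if-float (_÷ℕ (q ^ m ∸ 1)) ((δ + k) ℕ.≤ᵇ N)))

  normalizedCoeff-≤ : ∀ {N i} g → i ≤ N → normalizedCoeff N g i ≡ g i ÷ℕ gauss q N i
  normalizedCoeff-≤ g i≤N = if-T (ℕ.≤⇒≤ᵇ i≤N)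

  normalizedCoeff-> : ∀ {N i} g → N < i → normalizedCoeff N g i ≡ 0ℚ
  normalizedCoeff-> {N} {i} g N<i = if-¬T (ℕ.<⇒≱ N<i ∘ ℕ.≤ᵇ⇒≤ i N)

  normalizedCoeff-top : ∀ N g → normalizedCoeff N g N ≡ g N
  normalizedCoeff-top N g = begin
    normalizedCoeff N g N    ≡⟨ normalizedCoeff-≤ g (ℕ.≤-refl {N}) ⟩
    g N ÷ℕ gauss q N N       ≡⟨ cong (g N ÷ℕ_) (gauss-N-N≡1 q N) ⟩
    g N ÷ℕ 1                 ≡⟨ ÷ℕ-1 (g N) ⟩
    g N                      ∎
    where open ≡-Reasoning

  gauss-absorbʳ-÷ℕ : ∀ {N i} x → i ≤ N →
    ((x ℚ.* br (suc N ∸ i)) ÷ℕ gauss q (suc N) 1) ÷ℕ gauss q N i ≡ x ÷ℕ gauss q (suc N) i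
  gauss-absorbʳ-÷ℕ {N} {i} x i≤N = ÷ℕ-rescale x (gauss q (suc N) i) (qInt q (suc N ∸ i)) (gauss q (suc N) 1) (gauss q N i)
    {{qInt-suc-nonZero q N}} {{gauss-nonZero q i≤N}} (gauss-absorbʳ q i≤N)

  gauss-absorbˡ-÷ℕ : ∀ {N i} x → i ≤ N →
    ((x ℚ.* br (suc i)) ÷ℕ gauss q (suc N) 1) ÷ℕ gauss q N i ≡ x ÷ℕ gauss q (suc N) (suc i)
  gauss-absorbˡ-÷ℕ {N} {i} x i≤N = ÷ℕ-rescale x (gauss q (suc N) (suc i)) (qInt q (suc i)) (gauss q (suc N) 1) (gauss q N i)
    {{qInt-suc-nonZero q N}} {{gauss-nonZero q i≤N}} (gauss-absorbˡ q i≤N)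

  normalizedCoeff-𝒮 : ∀ N w i →
    normalizedCoeff N (𝒮 (suc N) w) i
      ≡ normalizedCoeff (suc N) w i ℚ.- monomial (w (suc N)) (suc N) i
  normalizedCoeff-𝒮 N w i with ℕ.<-cmp i (suc N)
  ... | tri< i<n i≢n _ = begin
      normalizedCoeff N (𝒮 (suc N) w) i
    ≡⟨ normalizedCoeff-≤ (𝒮 (suc N) w) (ℕ.≤-pred i<n) ⟩
      ((w i ℚ.* br (suc N ∸ i)) ÷ℕ gauss q (suc N) 1) ÷ℕ gauss q N i
    ≡⟨ gauss-absorbʳ-÷ℕ (w i) (ℕ.≤-pred i<n) ⟩
      w i ÷ℕ gauss q (suc N) i
    ≡⟨ normalizedCoeff-≤ w (ℕ.<⇒≤ i<n) ⟨
      normalizedCoeff (suc N) w i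
    ≡⟨ ℚ.+-identityʳ _ ⟨
      normalizedCoeff (suc N) w i ℚ.- 0ℚ
    ≡⟨ cong (ℚ._-_ (normalizedCoeff (suc N) w i)) (monomial-≢ (w (suc N)) i≢n) ⟨
      normalizedCoeff (suc N) w i ℚ.- monomial (w (suc N)) (suc N) i ∎
    where open ≡-Reasoning
  ... | tri≈ _ refl _ = begin
      normalizedCoeff N (𝒮 (suc N) w) (suc N)
    ≡⟨ normalizedCoeff-> (𝒮 (suc N) w) (ℕ.n<1+n N) ⟩
      0ℚ
    ≡⟨ ℚ.+-inverseʳ (w (suc N)) ⟨
      w (suc N) ℚ.- w (suc N)
    ≡⟨ cong₂ ℚ._-_ (normalizedCoeff-top (suc N) w) (monomial-≡ (w (suc N)) (suc N)) ⟨
      normalizedCoeff (suc N) w (suc N) ℚ.- monomial (w (suc N)) (suc N) (suc N) ∎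
    where open ≡-Reasoning
  ... | tri> _ i≢n n<i =
    trans (normalizedCoeff-> (𝒮 (suc N) w) (ℕ.<-trans (ℕ.n<1+n N) n<i))
          (sym (cong₂ ℚ._-_ (normalizedCoeff-> w n<i) (monomial-≢ (w (suc N)) i≢n)))

  normalizedCoeff-𝒫 : ∀ N w i →
    normalizedCoeff N (𝒫 (suc N) w) i
      ≡ (ℕ→ℚ (q ^ i) ℚ.* normalizedCoeff (suc N) w i ℚ.+ normalizedCoeff (suc N) w (suc i))
        ℚ.- monomial (ℕ→ℚ (q ^ suc N) ℚ.* w (suc N)) (suc N) i
  normalizedCoeff-𝒫 N w i with ℕ.<-cmp i (suc N)
  ... | tri< i<n i≢n _ = begin
      normalizedCoeff N (𝒫 (suc N) w) i
    ≡⟨ normalizedCoeff-≤ (𝒫 (suc N) w) i≤N ⟩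
      ((A ℚ.+ B) ÷ℕ gauss q (suc N) 1) ÷ℕ gauss q N i
    ≡⟨ trans (cong (_÷ℕ gauss q N i) (÷ℕ-distrib-+ (gauss q (suc N) 1) A B))
             (÷ℕ-distrib-+ (gauss q N i) _ _) ⟩
      (A ÷ℕ gauss q (suc N) 1) ÷ℕ gauss q N i ℚ.+ (B ÷ℕ gauss q (suc N) 1) ÷ℕ gauss q N i
    ≡⟨ cong₂ ℚ._+_ (gauss-absorbʳ-÷ℕ (w i ℚ.* Qⁱ) i≤N) (gauss-absorbˡ-÷ℕ (w (suc i)) i≤N) ⟩
      (w i ℚ.* Qⁱ) ÷ℕ gauss q (suc N) i ℚ.+ w (suc i) ÷ℕ gauss q (suc N) (suc i)
    ≡⟨ cong (ℚ._+ w (suc i) ÷ℕ gauss q (suc N) (suc i))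
            (trans (cong (_÷ℕ gauss q (suc N) i) (ℚ.*-comm (w i) Qⁱ))
                   (sym (*-÷ℕ-assoc (gauss q (suc N) i) Qⁱ (w i)))) ⟩
      Qⁱ ℚ.* (w i ÷ℕ gauss q (suc N) i) ℚ.+ w (suc i) ÷ℕ gauss q (suc N) (suc i)
    ≡⟨ cong₂ (λ a b → Qⁱ ℚ.* a ℚ.+ b) (normalizedCoeff-≤ w (ℕ.<⇒≤ i<n))
                                      (normalizedCoeff-≤ w i<n) ⟨
      Qⁱ ℚ.* normalizedCoeff (suc N) w i ℚ.+ normalizedCoeff (suc N) w (suc i)
    ≡⟨ ℚ.+-identityʳ _ ⟨
      (Qⁱ ℚ.* normalizedCoeff (suc N) w i ℚ.+ normalizedCoeff (suc N) w (suc i)) ℚ.- 0ℚ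
    ≡⟨ cong (ℚ._-_ (Qⁱ ℚ.* normalizedCoeff (suc N) w i ℚ.+ normalizedCoeff (suc N) w (suc i))) (monomial-≢ (ℕ→ℚ (q ^ suc N) ℚ.* w (suc N)) i≢n) ⟨
      (Qⁱ ℚ.* normalizedCoeff (suc N) w i ℚ.+ normalizedCoeff (suc N) w (suc i))
        ℚ.- monomial (ℕ→ℚ (q ^ suc N) ℚ.* w (suc N)) (suc N) i ∎
    where
      open ≡-Reasoning
      i≤N = ℕ.≤-pred i<n
      Qⁱ = ℕ→ℚ (q ^ i)
      A = (w i ℚ.* Qⁱ) ℚ.* br (suc N ∸ i)
      B = w (suc i) ℚ.* br (suc i)
  ... | tri≈ _ refl _ = begin
      normalizedCoeff N (𝒫 (suc N) w) (suc N)
    ≡⟨ normalizedCoeff-> (𝒫 (suc N) w) (ℕ.n<1+n N) ⟩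
      0ℚ
    ≡⟨ ℚ.+-inverseʳ top ⟨
      top ℚ.- top
    ≡⟨ cong (ℚ._- top) (ℚ.+-identityʳ top) ⟨
      (top ℚ.+ 0ℚ) ℚ.- top
    ≡⟨ cong₃ (λ a b c → (ℕ→ℚ (q ^ suc N) ℚ.* a ℚ.+ b) ℚ.- c)
             (normalizedCoeff-top (suc N) w)
             (normalizedCoeff-> w (ℕ.n<1+n (suc N)))
             (monomial-≡ top (suc N)) ⟨
      (ℕ→ℚ (q ^ suc N) ℚ.* normalizedCoeff (suc N) w (suc N) ℚ.+ normalizedCoeff (suc N) w (suc (suc N)))
        ℚ.- monomial top (suc N) (suc N) ∎
    where
      open ≡-Reasoning
      top = ℕ→ℚ (q ^ suc N) ℚ.* w (suc N)
  ... | tri> _ i≢n n<i = begin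
      normalizedCoeff N (𝒫 (suc N) w) i
    ≡⟨ normalizedCoeff-> (𝒫 (suc N) w) (ℕ.<-trans (ℕ.n<1+n N) n<i) ⟩
      0ℚ
    ≡⟨ trans (trans (ℚ.+-identityʳ _) (ℚ.+-identityʳ _)) (ℚ.*-zeroʳ (ℕ→ℚ (q ^ i))) ⟨
      ℕ→ℚ (q ^ i) ℚ.* 0ℚ ℚ.+ 0ℚ ℚ.- 0ℚ
    ≡⟨ cong₃ (λ a b c → (ℕ→ℚ (q ^ i) ℚ.* a ℚ.+ b) ℚ.- c)
             (normalizedCoeff-> w n<i)
             (normalizedCoeff-> w (ℕ.m<n⇒m<1+n n<i))
             (monomial-≢ (ℕ→ℚ (q ^ suc N) ℚ.* w (suc N)) i≢n) ⟨
      (ℕ→ℚ (q ^ i) ℚ.* normalizedCoeff (suc N) w i ℚ.+ normalizedCoeff (suc N) w (suc i))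
        ℚ.- monomial (ℕ→ℚ (q ^ suc N) ℚ.* w (suc N)) (suc N) i ∎
    where open ≡-Reasoning

  normalizedCoeff-minusXpow-0 : ∀ N g → normalizedCoeff N (minusXpow g) 0 ≡ normalizedCoeff N g 0 ℚ.- 1ℚ
  normalizedCoeff-minusXpow-0 N g = trans (÷ℕ-1 (g 0 ℚ.- 1ℚ)) (cong (ℚ._- 1ℚ) (sym (÷ℕ-1 (g 0))))

  normalizedCoeff-0 : ∀ N g {i} → g i ≡ 0ℚ → normalizedCoeff N g i ≡ 0ℚ
  normalizedCoeff-0 N g {i} gᵢ≡0 with i ℕ.≤ᵇ N
  ... | true  = trans (cong (_÷ℕ gauss q N i) gᵢ≡0) (0ℚ-÷ℕ (gauss q N i))
  ... | false = refl

  -- The leading coefficient of 𝒫(f) − x^(n−1) comes only from the y-derivative: below the minimum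
  -- distance f has just its constant term 1, which the subtracted x^(n−1) cancels.
  normalizedCoeff-𝒫-start : ∀ N w δ → w 0 ≡ 1ℚ → (∀ t → 0 < t → t < suc δ → w t ≡ 0ℚ) → suc δ ≤ suc N →
    normalizedCoeff N (minusXpow (𝒫 (suc N) w)) δ ≡ normalizedCoeff (suc N) w (suc δ)
  normalizedCoeff-𝒫-start N w zero w₀≡1 _ _ = begin
      normalizedCoeff N (minusXpow (𝒫 (suc N) w)) 0
    ≡⟨ normalizedCoeff-minusXpow-0 N (𝒫 (suc N) w) ⟩
      normalizedCoeff N (𝒫 (suc N) w) 0 ℚ.- 1ℚ
    ≡⟨ cong (ℚ._- 1ℚ) (normalizedCoeff-𝒫 N w 0) ⟩
      ((1ℚ ℚ.* (w 0 ÷ℕ 1) ℚ.+ b) ℚ.- 0ℚ) ℚ.- 1ℚ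
    ≡⟨ cong (λ a → ((1ℚ ℚ.* a ℚ.+ b) ℚ.- 0ℚ) ℚ.- 1ℚ) (trans (÷ℕ-1 (w 0)) w₀≡1) ⟩
      ((1ℚ ℚ.+ b) ℚ.- 0ℚ) ℚ.- 1ℚ
    ≡⟨ cong (ℚ._- 1ℚ) (trans (ℚ.+-identityʳ _) (ℚ.+-comm 1ℚ b)) ⟩
      (b ℚ.+ 1ℚ) ℚ.- 1ℚ
    ≡⟨ ℚ.+-assoc b 1ℚ (ℚ.- 1ℚ) ⟩
      b ℚ.+ (1ℚ ℚ.- 1ℚ)
    ≡⟨ ℚ.+-identityʳ b ⟩
      b ∎
    where
      open ≡-Reasoning
      b = normalizedCoeff (suc N) w 1
  normalizedCoeff-𝒫-start N w (suc δ) _ w<d≡0 d≤n = begin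
      normalizedCoeff N (𝒫 (suc N) w) (suc δ)
    ≡⟨ normalizedCoeff-𝒫 N w (suc δ) ⟩
      (Q ℚ.* normalizedCoeff (suc N) w (suc δ) ℚ.+ b) ℚ.- monomial top (suc N) (suc δ)
    ≡⟨ cong₂ (λ a c → (Q ℚ.* a ℚ.+ b) ℚ.- c)
             (normalizedCoeff-0 (suc N) w (w<d≡0 (suc δ) (s≤s z≤n) (ℕ.n<1+n (suc δ))))
             (monomial-≢ top (ℕ.<⇒≢ d≤n)) ⟩
      (Q ℚ.* 0ℚ ℚ.+ b) ℚ.- 0ℚ
    ≡⟨ ℚ.+-identityʳ _ ⟩
      Q ℚ.* 0ℚ ℚ.+ b
    ≡⟨ cong (ℚ._+ b) (ℚ.*-zeroʳ Q) ⟩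
      0ℚ ℚ.+ b
    ≡⟨ ℚ.+-identityˡ b ⟩
      b ∎
    where
      open ≡-Reasoning
      Q = ℕ→ℚ (q ^ suc δ)
      b = normalizedCoeff (suc N) w (suc (suc δ))
      top = ℕ→ℚ (q ^ suc N) ℚ.* w (suc N)

  normalize-𝒮 : ∀ m N {d} w → 0 < d → d ≤ suc N → ∀ k →
    normalize m N d (minusXpow (𝒮 (suc N) w)) k
      ≡ (normalize m (suc N) d w ⊖ monomial (w (suc N) ÷ℕ (q ^ m ∸ 1)) (suc N ∸ d)) k
  normalize-𝒮 m N {suc δ} w _ d≤n k = begin
      normalize m N d (minusXpow (𝒮 n w)) k
    ≡⟨ normalize≡normalizedCoeff m N d (minusXpow (𝒮 n w)) k ⟩
      normalizedCoeff N (minusXpow (𝒮 n w)) (d + k) ÷ℕ c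
    -- minusXpow only changes the coefficient of index 0, and d + k is a successor
    ≡⟨⟩
      normalizedCoeff N (𝒮 n w) (d + k) ÷ℕ c
    ≡⟨ cong (_÷ℕ c) (normalizedCoeff-𝒮 N w (d + k)) ⟩
      (normalizedCoeff n w (d + k) ℚ.- monomial (w n) n (d + k)) ÷ℕ c
    ≡⟨ ÷ℕ-distrib-- c _ _ ⟩
      normalizedCoeff n w (d + k) ÷ℕ c ℚ.- monomial (w n) n (d + k) ÷ℕ c
    ≡⟨ cong₂ ℚ._-_ (sym (normalize≡normalizedCoeff m n d w k))
                   (trans (monomial-÷ℕ (w n) n (d + k) c) (monomial-+ (w n ÷ℕ c) k d≤n)) ⟩
      normalize m n d w k ℚ.- monomial (w n ÷ℕ c) (n ∸ d) k ∎
    where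
      open ≡-Reasoning
      n = suc N
      d = suc δ
      c = q ^ m ∸ 1

  normalize-𝒫 : ∀ m N {d} w → w 0 ≡ 1ℚ → (∀ t → 0 < t → t < d → w t ≡ 0ℚ) → 0 < d → d ≤ suc N → ∀ k →
    normalize m N (d ∸ 1) (minusXpow (𝒫 (suc N) w)) k
      ≡ ((Tmul (scalePoly (ℕ→ℚ (q ^ d)) (atScaled q (normalize m (suc N) d w)))
           ⊕ normalize m (suc N) d w)
         ⊖ monomial ((w (suc N) ℚ.* ℕ→ℚ (q ^ suc N)) ÷ℕ (q ^ m ∸ 1)) (suc N ∸ d + 1)) k
  normalize-𝒫 m N {suc δ} w w₀≡1 w<d≡0 _ d≤n zero = begin
      normalize m N δ (minusXpow (𝒫 n w)) 0
    ≡⟨ normalize≡normalizedCoeff m N δ (minusXpow (𝒫 n w)) 0 ⟩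
      normalizedCoeff N (minusXpow (𝒫 n w)) (δ + 0) ÷ℕ c
    ≡⟨ cong (λ i → normalizedCoeff N (minusXpow (𝒫 n w)) i ÷ℕ c) (ℕ.+-identityʳ δ) ⟩
      normalizedCoeff N (minusXpow (𝒫 n w)) δ ÷ℕ c
    ≡⟨ cong (_÷ℕ c) (normalizedCoeff-𝒫-start N w δ w₀≡1 w<d≡0 d≤n) ⟩
      normalizedCoeff n w d ÷ℕ c
    ≡⟨ cong (λ i → normalizedCoeff n w i ÷ℕ c) (ℕ.+-identityʳ d) ⟨
      normalizedCoeff n w (d + 0) ÷ℕ c
    ≡⟨ normalize≡normalizedCoeff m n d w 0 ⟨
      normalize m n d w 0
    ≡⟨ trans (ℚ.+-identityʳ _) (ℚ.+-identityˡ _) ⟨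
      (0ℚ ℚ.+ normalize m n d w 0) ℚ.- 0ℚ
    ≡⟨ cong (ℚ._-_ (0ℚ ℚ.+ normalize m n d w 0))
            (monomial-≢ X (λ 0≡ → ℕ.0≢1+n (trans 0≡ (ℕ.+-comm (n ∸ d) 1)))) ⟨
      (0ℚ ℚ.+ normalize m n d w 0) ℚ.- monomial X (n ∸ d + 1) 0 ∎
    where
      open ≡-Reasoning
      n = suc N
      d = suc δ
      c = q ^ m ∸ 1
      X = (w n ℚ.* ℕ→ℚ (q ^ n)) ÷ℕ c
  normalize-𝒫 m N {suc δ} w _ _ _ d≤n (suc k) = begin
      normalize m N δ (minusXpow (𝒫 n w)) (suc k)
    ≡⟨ normalize≡normalizedCoeff m N δ (minusXpow (𝒫 n w)) (suc k) ⟩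
      normalizedCoeff N (minusXpow (𝒫 n w)) (δ + suc k) ÷ℕ c
    ≡⟨ cong (λ i → normalizedCoeff N (minusXpow (𝒫 n w)) i ÷ℕ c) (ℕ.+-suc δ k) ⟩
      normalizedCoeff N (𝒫 n w) (d + k) ÷ℕ c
    ≡⟨ cong (_÷ℕ c) (normalizedCoeff-𝒫 N w (d + k)) ⟩
      ((ℕ→ℚ (q ^ (d + k)) ℚ.* a ℚ.+ b) ℚ.- μ) ÷ℕ c
    ≡⟨ trans (÷ℕ-distrib-- c _ μ) (cong (ℚ._- μ ÷ℕ c) (÷ℕ-distrib-+ c _ b)) ⟩
      ((ℕ→ℚ (q ^ (d + k)) ℚ.* a) ÷ℕ c ℚ.+ b ÷ℕ c) ℚ.- μ ÷ℕ c
    ≡⟨ cong₂ (λ u v → (u ℚ.+ b ÷ℕ c) ℚ.- v) powers-split monomial-rescale ⟩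
      (ℕ→ℚ (q ^ d) ℚ.* (ℕ→ℚ (q ^ k) ℚ.* (a ÷ℕ c)) ℚ.+ b ÷ℕ c) ℚ.- monomial X (n ∸ d) k
    ≡⟨ cong₂ (λ u v → (ℕ→ℚ (q ^ d) ℚ.* (ℕ→ℚ (q ^ k) ℚ.* u) ℚ.+ v) ℚ.- monomial X (n ∸ d) k)
             (normalize≡normalizedCoeff m n d w k)
             (trans (normalize≡normalizedCoeff m n d w (suc k))
                    (cong (λ i → normalizedCoeff n w i ÷ℕ c) (ℕ.+-suc d k))) ⟨
      (ℕ→ℚ (q ^ d) ℚ.* (ℕ→ℚ (q ^ k) ℚ.* normalize m n d w k) ℚ.+ normalize m n d w (suc k))
        ℚ.- monomial X (n ∸ d) k
    ≡⟨ cong (λ e → (ℕ→ℚ (q ^ d) ℚ.* (ℕ→ℚ (q ^ k) ℚ.* normalize m n d w k) ℚ.+ normalize m n d w (suc k))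
                     ℚ.- monomial X e (suc k))
            (ℕ.+-comm (n ∸ d) 1) ⟨
      (ℕ→ℚ (q ^ d) ℚ.* (ℕ→ℚ (q ^ k) ℚ.* normalize m n d w k) ℚ.+ normalize m n d w (suc k))
        ℚ.- monomial X (n ∸ d + 1) (suc k) ∎
    where
      open ≡-Reasoning
      n = suc N
      d = suc δ
      c = q ^ m ∸ 1
      a = normalizedCoeff n w (d + k)
      b = normalizedCoeff n w (suc (d + k))
      μ = monomial (ℕ→ℚ (q ^ n) ℚ.* w n) n (d + k)
      X = (w n ℚ.* ℕ→ℚ (q ^ n)) ÷ℕ c
      powers-split : (ℕ→ℚ (q ^ (d + k)) ℚ.* a) ÷ℕ c ≡ ℕ→ℚ (q ^ d) ℚ.* (ℕ→ℚ (q ^ k) ℚ.* (a ÷ℕ c))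
      powers-split = begin
        (ℕ→ℚ (q ^ (d + k)) ℚ.* a) ÷ℕ c                ≡⟨ *-÷ℕ-assoc c (ℕ→ℚ (q ^ (d + k))) a ⟨
        ℕ→ℚ (q ^ (d + k)) ℚ.* (a ÷ℕ c)                ≡⟨ cong (ℚ._* (a ÷ℕ c)) (ℕ→ℚ-^ q d k) ⟨
        ℕ→ℚ (q ^ d) ℚ.* ℕ→ℚ (q ^ k) ℚ.* (a ÷ℕ c)      ≡⟨ ℚ.*-assoc (ℕ→ℚ (q ^ d)) _ _ ⟩
        ℕ→ℚ (q ^ d) ℚ.* (ℕ→ℚ (q ^ k) ℚ.* (a ÷ℕ c))    ∎
      monomial-rescale : μ ÷ℕ c ≡ monomial X (n ∸ d) k
      monomial-rescale = begin
        μ ÷ℕ c                                           ≡⟨ monomial-÷ℕ _ n (d + k) c ⟩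
        monomial ((ℕ→ℚ (q ^ n) ℚ.* w n) ÷ℕ c) n (d + k)  ≡⟨ cong (λ x → monomial (x ÷ℕ c) n (d + k)) (ℚ.*-comm _ (w n)) ⟩
        monomial X n (d + k)                             ≡⟨ monomial-+ X k d≤n ⟩
        monomial X (n ∸ d) k                             ∎

-- Counting, and the rank of a matrix

count : ∀ {A : Set} → (A → Bool) → List A → ℕ
count p xs = length (filterᵇ p xs)

count-∷ : ∀ {A : Set} (p : A → Bool) x xs → count p (x ∷ xs) ≡ (if p x then 1 else 0) + count p xs
count-∷ p x xs with p x
... | true  = refl
... | false = refl

count-++ : ∀ {A : Set} (p : A → Bool) xs ys → count p (xs ++ ys) ≡ count p xs + count p ys
count-++ p xs ys = trans (cong length (List.filter-++ (T? ∘ p) xs ys)) (List.length-++ (filterᵇ p xs))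

count-map : ∀ {A B : Set} (p : B → Bool) (f : A → B) xs → count p (List.map f xs) ≡ count (p ∘ f) xs
count-map p f []       = refl
count-map p f (x ∷ xs) = trans (count-∷ p (f x) (List.map f xs))
                               (trans (cong ((if p (f x) then 1 else 0) +_) (count-map p f xs))
                                      (sym (count-∷ (p ∘ f) x xs)))

count-≗ : ∀ {A : Set} {p p′ : A → Bool} → (∀ x → p x ≡ p′ x) → ∀ xs → count p xs ≡ count p′ xs
count-≗ p≗p′ []       = refl
count-≗ {p = p} {p′} p≗p′ (x ∷ xs) =
  trans (count-∷ p x xs)
        (trans (cong₂ (λ b c → (if b then 1 else 0) + c) (p≗p′ x) (count-≗ p≗p′ xs))
               (sym (count-∷ p′ x xs)))

count-none : ∀ {A : Set} (p : A → Bool) → (∀ x → ¬ T (p x)) → ∀ xs → count p xs ≡ 0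
count-none p ¬p xs = cong length (List.filter-none (T? ∘ p) (All.universal ¬p xs))

count-∧ˡ : ∀ {A : Set} b (p : A → Bool) xs → count (λ x → b ∧ p x) xs ≡ (if b then 1 else 0) * count p xs
count-∧ˡ true  p xs = sym (ℕ.+-identityʳ (count p xs))
count-∧ˡ false p xs = count-none (λ _ → false) (λ _ ()) xs

count-≟-allFin : ∀ N (t : Fin N) → count (λ j → ⌊ j Fin.≟ t ⌋) (List.allFin N) ≡ 1
count-≟-allFin (suc N) Fin.zero
  rewrite sym (List.map-tabulate (λ j → j) (Fin.suc {N})) =
  cong suc (trans (count-map _ Fin.suc (List.allFin N)) (count-none _ (λ _ ()) (List.allFin N)))
count-≟-allFin (suc N) (Fin.suc t)
  rewrite sym (List.map-tabulate (λ j → j) (Fin.suc {N})) =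
  trans (count-map _ Fin.suc (List.allFin N))
        (trans (count-≗ (λ j → ⌊⌋-map′ (cong Fin.suc) Fin.suc-injective (j Fin.≟ t)) (List.allFin N))
               (count-≟-allFin N t))

allᶠ : ∀ {A : Set} {k} → (A → Bool) → (Fin k → A) → Bool
allᶠ {k = zero}  p f = true
allᶠ {k = suc k} p f = p (f Fin.zero) ∧ allᶠ p (f ∘ Fin.suc)

allᶠ-sound : ∀ {A : Set} {k} (p : A → Bool) (f : Fin k → A) → T (allᶠ p f) → ∀ i → T (p (f i))
allᶠ-sound {k = suc k} p f t Fin.zero    = proj₁ (Equivalence.to Bool.T-∧ t)
allᶠ-sound {k = suc k} p f t (Fin.suc i) = allᶠ-sound p (f ∘ Fin.suc) (proj₂ (Equivalence.to Bool.T-∧ t)) i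

allᶠ-complete : ∀ {A : Set} {k} (p : A → Bool) (f : Fin k → A) → (∀ i → T (p (f i))) → T (allᶠ p f)
allᶠ-complete {k = zero}  p f h = _
allᶠ-complete {k = suc k} p f h =
  Equivalence.from Bool.T-∧ (h Fin.zero , allᶠ-complete p (f ∘ Fin.suc) (h ∘ Fin.suc))

maxLength : ∀ {A : Set} → (List A → Bool) → List (List A) → ℕ
maxLength p = List.foldr (λ S r → if p S then length S ℕ.⊔ r else r) 0

maxLength-≤ : ∀ {A : Set} (p : List A → Bool) {B} Ss → All (λ S → length S ≤ B) Ss → maxLength p Ss ≤ B
maxLength-≤ p []       []           = z≤n
maxLength-≤ p (S ∷ Ss) (S≤B ∷ Ss≤B) with p S
... | true  = ℕ.⊔-lub S≤B (maxLength-≤ p Ss Ss≤B)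
... | false = maxLength-≤ p Ss Ss≤B

maxLength-≥ : ∀ {A : Set} (p : List A → Bool) {S Ss} → S ∈ Ss → T (p S) → length S ≤ maxLength p Ss
maxLength-≥ p {S} {S ∷ Ss} (here refl) t with p S
... | true = ℕ.m≤m⊔n (length S) (maxLength p Ss)
maxLength-≥ p {S} {S′ ∷ Ss} (there S∈Ss) t with p S′
... | true  = ℕ.≤-trans (maxLength-≥ p S∈Ss t) (ℕ.m≤n⊔m (length S′) (maxLength p Ss))
... | false = maxLength-≥ p S∈Ss t

maxLength-≡0 : ∀ {A : Set} (p : List A → Bool) → (∀ S → T (p S) → length S ≡ 0) → ∀ Ss → maxLength p Ss ≡ 0
maxLength-≡0 p only[] []       = refl
maxLength-≡0 p only[] (S ∷ Ss) with p S in eq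
... | true  = trans (cong (ℕ._⊔ maxLength p Ss) (only[] S (subst T (sym eq) _))) (maxLength-≡0 p only[] Ss)
... | false = maxLength-≡0 p only[] Ss

module _ {q : ℕ} (F : FiniteField q) where
  private
    module F = FiniteField F
    module Card = Inverse F.card
  open F using (Carrier; _≈_; 0#; 1#)

  ==⇒≈ : ∀ {x y} → T (_==_ F x y) → x ≈ y
  ==⇒≈ {x} {y} t = begin
    x                      ≈⟨ Card.strictlyInverseʳ x ⟨
    Card.from (Card.to x)  ≡⟨ cong Card.from (toWitness t) ⟩
    Card.from (Card.to y)  ≈⟨ Card.strictlyInverseʳ y ⟩
    y                      ∎
    where open SetoidReasoning F.setoid

  ≈⇒== : ∀ {x y} → x ≈ y → T (_==_ F x y)
  ≈⇒== x≈y = fromWitness (Card.to-cong x≈y)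

  _≈?_ : ∀ x y → Dec (x ≈ y)
  x ≈? y = map′ ==⇒≈ ≈⇒== (T? (_==_ F x y))

  *-nonZero : ∀ {a b} → ¬ a ≈ 0# → ¬ b ≈ 0# → ¬ (a F.* b) ≈ 0#
  *-nonZero {a} {b} a≉0 b≉0 ab≈0 with F.inv a a≉0
  ... | a⁻¹ , aa⁻¹≈1 = b≉0 (begin
    b                 ≈⟨ F.*-identityˡ b ⟨
    1# F.* b          ≈⟨ F.*-congʳ (F.trans (F.*-comm a⁻¹ a) aa⁻¹≈1) ⟨
    a⁻¹ F.* a F.* b   ≈⟨ F.*-assoc a⁻¹ a b ⟩
    a⁻¹ F.* (a F.* b) ≈⟨ F.*-congˡ ab≈0 ⟩
    a⁻¹ F.* 0#        ≈⟨ F.zeroʳ a⁻¹ ⟩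
    0#                ∎)
    where open SetoidReasoning F.setoid

  allB-universal : ∀ {A : Set} (p : A → Bool) → (∀ x → T (p x)) → ∀ xs → T (allB F p xs)
  allB-universal p h []       = _
  allB-universal p h (x ∷ xs) = Equivalence.from Bool.T-∧ (h x , allB-universal p h xs)

  allB-∈ : ∀ {A : Set} (p : A → Bool) {x xs} → T (allB F p xs) → x ∈ xs → T (p x)
  allB-∈ p t (here refl)  = proj₁ (Equivalence.to Bool.T-∧ t)
  allB-∈ p t (there x∈xs) = allB-∈ p (proj₂ (Equivalence.to Bool.T-∧ t)) x∈xs

  isZeroVec-sound : ∀ {k} (v : Fin k → Carrier) → T (isZeroVec F v) → ∀ i → v i ≈ 0#
  isZeroVec-sound {k} v t i = ==⇒≈ (allB-∈ (λ i → _==_ F (v i) 0#) t (∈-allFin i))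

  isZeroVec-complete : ∀ {k} (v : Fin k → Carrier) → (∀ i → v i ≈ 0#) → T (isZeroVec F v)
  isZeroVec-complete {k} v v≈0 = allB-universal (λ i → _==_ F (v i) 0#) (≈⇒== ∘ v≈0) (List.allFin k)

  sumF-zero : ∀ k (v : Fin k → Carrier) → (∀ j → v j ≈ 0#) → sumF F k v ≈ 0#
  sumF-zero zero    v v≈0 = F.refl
  sumF-zero (suc k) v v≈0 = F.trans (F.+-cong (v≈0 Fin.zero) (sumF-zero k (v ∘ Fin.suc) (v≈0 ∘ Fin.suc)))
                                    (F.+-identityˡ 0#)

  ∷-∈-allFuns : ∀ {A : Set} {x : A} {k xs f} → x ∈ xs → f ∈ allFuns F k xs → (x VF.∷ f) ∈ allFuns F (suc k) xs
  ∷-∈-allFuns {x = x} {k} {xs} {f} x∈xs f∈ =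
    ∈-concatMap⁺ (λ y → List.map (y VF.∷_) (allFuns F k xs)) (Any.map (λ { refl → ∈-map⁺ (x VF.∷_) f∈ }) x∈xs)

  allFuns-inhabited : ∀ {A : Set} {x : A} k xs → x ∈ xs → ∃ λ f → f ∈ allFuns F k xs
  allFuns-inhabited zero    xs x∈xs = _ , here refl
  allFuns-inhabited {x = x} (suc k) xs x∈xs with allFuns-inhabited k xs x∈xs
  ... | f , f∈ = x VF.∷ f , ∷-∈-allFuns x∈xs f∈

  sublists-length : ∀ {A : Set} (xs : List A) → All (λ S → length S ≤ length xs) (sublists F xs)
  sublists-length []       = ℕ.≤-refl ∷ []
  sublists-length (x ∷ xs) =
    All.++⁺ (All.map ℕ.m≤n⇒m≤1+n (sublists-length xs)) (All.map⁺ (All.map s≤s (sublists-length xs)))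

  []∈sublists : ∀ {A : Set} (xs : List A) → [] ∈ sublists F xs
  []∈sublists []       = here refl
  []∈sublists (x ∷ xs) = ∈-++⁺ˡ ([]∈sublists xs)

  [-]∈sublists : ∀ {A : Set} {y : A} {xs} → y ∈ xs → (y ∷ []) ∈ sublists F xs
  [-]∈sublists {xs = x ∷ xs} (here refl)  = ∈-++⁺ʳ (sublists F xs) (∈-map⁺ (x ∷_) ([]∈sublists xs))
  [-]∈sublists {xs = x ∷ xs} (there y∈xs) = ∈-++⁺ˡ ([-]∈sublists y∈xs)

  vanishing-combination⇒dependent : ∀ {k m} (v : Fin k → Fin m → Carrier) {a} → a ∈ allFuns F k (elements F) →
    (∀ i → lincomb F a v i ≈ 0#) → ¬ (∀ j → a j ≈ 0#) → ¬ T (independentᵇ F v)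
  vanishing-combination⇒dependent v {a} a∈ av≈0 a≉0 indep
    with Equivalence.to Bool.T-∨ (allB-∈ (λ a → not (isZeroVec F (lincomb F a v)) ∨ isZeroVec F a) indep a∈)
  ... | inj₁ t = T-not⇒¬T t (isZeroVec-complete (lincomb F a v) av≈0)
  ... | inj₂ t = a≉0 (isZeroVec-sound a t)

  zeroColumns-dependent : ∀ {k m} (v : Fin (suc k) → Fin m → Carrier) → (∀ j i → v j i ≈ 0#) → ¬ T (independentᵇ F v)
  zeroColumns-dependent {k} v v≈0 =
    let g , g∈ = allFuns-inhabited k (elements F) e∈
        a = e VF.∷ g
    in vanishing-combination⇒dependent v (∷-∈-allFuns e∈ g∈)
         (λ i → sumF-zero (suc k) (λ j → a j F.* v j i) (λ j → F.trans (F.*-congˡ (v≈0 j i)) (F.zeroʳ (a j))))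
         (λ a≈0 → e≉0 (a≈0 Fin.zero))
    where
      e = Card.from (Card.to 1#)
      e∈ : e ∈ elements F
      e∈ = ∈-map⁺ Card.from (∈-allFin (Card.to 1#))
      e≉0 : ¬ e ≈ 0#
      e≉0 e≈0 = F.1≉0 (F.trans (F.sym (Card.strictlyInverseʳ 1#)) e≈0)

  nonzeroColumn-independent : ∀ {m} (v : Fin 1 → Fin m → Carrier) i → ¬ v Fin.zero i ≈ 0# → T (independentᵇ F v)
  nonzeroColumn-independent v i v≉0 = allB-universal _ test (allFuns F 1 (elements F))
    where
      test : ∀ a → T (not (isZeroVec F (lincomb F a v)) ∨ isZeroVec F a)
      test a with a Fin.zero ≈? 0#
      ... | yes a₀≈0 = Equivalence.from Bool.T-∨ (inj₂ (isZeroVec-complete a λ { Fin.zero → a₀≈0 }))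
      ... | no  a₀≉0 = Equivalence.from Bool.T-∨ (inj₁ (¬T⇒T-not λ t →
            *-nonZero a₀≉0 v≉0 (F.trans (F.sym (F.+-identityʳ _)) (isZeroVec-sound (lincomb F a v) t i))))

  rank-≤ : ∀ {m n} (M : Mat F m n) → rank F M ≤ n
  rank-≤ {n = n} M = maxLength-≤ _ (sublists F (List.allFin n))
    (subst (λ B → All (λ S → length S ≤ B) (sublists F (List.allFin n)))
           (List.length-tabulate (λ j → j)) (sublists-length (List.allFin n)))

  rank-0M : ∀ {m n} (M : Mat F m n) → _≈M_ F M (0M F) → rank F M ≡ 0
  rank-0M {n = n} M M≈0 = maxLength-≡0 _ only[] (sublists F (List.allFin n))
    where
      only[] : ∀ S → T (independentᵇ F (λ j i → M i (List.lookup S j))) → length S ≡ 0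
      only[] []      _     = refl
      only[] S@(_ ∷ _) indep = ⊥-elim (zeroColumns-dependent _ (λ j i → M≈0 i (List.lookup S j)) indep)

  rank-≥1 : ∀ {m n} (M : Mat F m n) i j → ¬ M i j ≈ 0# → 1 ≤ rank F M
  rank-≥1 M i j Mij≉0 = maxLength-≥ _ ([-]∈sublists (∈-allFin j)) (nonzeroColumn-independent (λ k i → M i (List.lookup (j ∷ []) k)) i Mij≉0)

  rank≡0⇒≈0M : ∀ {m n} (M : Mat F m n) → rank F M ≡ 0 → _≈M_ F M (0M F)
  rank≡0⇒≈0M M rank≡0 i j =
    decidable-stable (M i j ≈? 0#) (λ Mij≉0 → ℕ.<⇒≢ (rank-≥1 M i j Mij≉0) (sym rank≡0))

  count-allᶠ-allFuns : ∀ {A : Set} (p : A → Bool) k xs → count (allᶠ p) (allFuns F k xs) ≡ count p xs ^ k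
  count-allᶠ-allFuns p zero    xs = refl
  count-allᶠ-allFuns p (suc k) xs =
    trans (count-prepend xs) (cong (count p xs *_) (count-allᶠ-allFuns p k xs))
    where
      fs = allFuns F k xs
      count-prepend : ∀ ys → count (allᶠ p) (List.concatMap (λ y → List.map (y VF.∷_) fs) ys)
                               ≡ count p ys * count (allᶠ p) fs
      count-prepend []       = refl
      count-prepend (y ∷ ys) = begin
          count (allᶠ p) (List.map (y VF.∷_) fs ++ List.concatMap (λ y → List.map (y VF.∷_) fs) ys)
        ≡⟨ count-++ (allᶠ p) (List.map (y VF.∷_) fs) _ ⟩
          count (allᶠ p) (List.map (y VF.∷_) fs) + count (allᶠ p) (List.concatMap (λ y → List.map (y VF.∷_) fs) ys)
        ≡⟨ cong₂ _+_ (trans (count-map (allᶠ p) (y VF.∷_) fs) (count-∧ˡ (p y) (allᶠ p) fs)) (count-prepend ys) ⟩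
          (if p y then 1 else 0) * count (allᶠ p) fs + count p ys * count (allᶠ p) fs
        ≡⟨ ℕ.*-distribʳ-+ (count (allᶠ p) fs) (if p y then 1 else 0) (count p ys) ⟨
          ((if p y then 1 else 0) + count p ys) * count (allᶠ p) fs
        ≡⟨ cong (_* count (allᶠ p) fs) (count-∷ p y ys) ⟨
          count p (y ∷ ys) * count (allᶠ p) fs ∎
        where open ≡-Reasoning

  isZeroMatᵇ : ∀ {m n} → Mat F m n → Bool
  isZeroMatᵇ = allᶠ (allᶠ (λ x → _==_ F x 0#))

  isZeroMatᵇ-sound : ∀ {m n} (M : Mat F m n) → T (isZeroMatᵇ M) → _≈M_ F M (0M F)
  isZeroMatᵇ-sound M t i j = ==⇒≈ (allᶠ-sound _ (M i) (allᶠ-sound _ M t i) j)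

  isZeroMatᵇ-complete : ∀ {m n} (M : Mat F m n) → _≈M_ F M (0M F) → T (isZeroMatᵇ M)
  isZeroMatᵇ-complete M M≈0 = allᶠ-complete _ M (λ i → allᶠ-complete _ (M i) (λ j → ≈⇒== (M≈0 i j)))

  count-zero-elements : count (λ x → _==_ F x 0#) (elements F) ≡ 1
  count-zero-elements =
    trans (count-map _ Card.from (List.allFin q))
          (trans (count-≗ (λ j → cong (λ t → ⌊ t Fin.≟ Card.to 0# ⌋) (Card.strictlyInverseˡ j)) (List.allFin q))
                 (count-≟-allFin q (Card.to 0#)))

  count-zero-matrices : ∀ m n → count isZeroMatᵇ (allMats F m n) ≡ 1
  count-zero-matrices m n = begin
    count isZeroMatᵇ (allMats F m n)                                ≡⟨ count-allᶠ-allFuns _ m _ ⟩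
    count (allᶠ (λ x → _==_ F x 0#)) (allFuns F n (elements F)) ^ m ≡⟨ cong (_^ m) (count-allᶠ-allFuns _ n _) ⟩
    (count (λ x → _==_ F x 0#) (elements F) ^ n) ^ m                ≡⟨ cong (λ c → (c ^ n) ^ m) count-zero-elements ⟩
    (1 ^ n) ^ m                                                     ≡⟨ cong (_^ m) (ℕ.^-zeroˡ n) ⟩
    1 ^ m                                                           ≡⟨ ℕ.^-zeroˡ m ⟩
    1                                                               ∎
    where open ≡-Reasoning

  -- Weight distribution of a linear code

  module _ {m n} {C : Mat F m n → Set} (code : IsLinearCode F C) (C? : ∀ M → Dec (C M))
           {d} (minDist : IsMinRankDistance F C d) where
    open IsLinearCode code

    minDistance-pos : 0 < d
    minDistance-pos with proj₁ minDist
    ... | M , _ , M≉0 , rankM≡d = ℕ.n≢0⇒n>0 (λ d≡0 → M≉0 (rank≡0⇒≈0M M (trans rankM≡d d≡0)))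

    minDistance-≤ : d ≤ n
    minDistance-≤ with proj₁ minDist
    ... | M , _ , _ , rankM≡d = subst (_≤ n) rankM≡d (rank-≤ M)

    W-0 : W F C? 0 ≡ 1
    W-0 = trans (cong length (List.filter-≐ (T? ∘ codewordOfRank0) (T? ∘ isZeroMatᵇ) (sound , complete) (allMats F m n)))
                (count-zero-matrices m n)
      where
        codewordOfRank0 : Mat F m n → Bool
        codewordOfRank0 M = ⌊ C? M ⌋ ∧ (rank F M ℕ.≡ᵇ 0)
        sound : ∀ {M} → T (codewordOfRank0 M) → T (isZeroMatᵇ M)
        sound {M} t = isZeroMatᵇ-complete M
          (rank≡0⇒≈0M M (ℕ.≡ᵇ⇒≡ (rank F M) 0 (proj₂ (Equivalence.to Bool.T-∧ t))))
        complete : ∀ {M} → T (isZeroMatᵇ M) → T (codewordOfRank0 M)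
        complete {M} t = Equivalence.from Bool.T-∧
          ( fromWitness (respects (λ i j → F.sym (isZeroMatᵇ-sound M t i j)) zero∈)
          , ℕ.≡⇒≡ᵇ (rank F M) 0 (rank-0M M (isZeroMatᵇ-sound M t)))

    W-<d : ∀ t → 0 < t → t < d → W F C? t ≡ 0
    W-<d t 0<t t<d = count-none _ no-codeword (allMats F m n)
      where
        no-codeword : ∀ M → ¬ T (⌊ C? M ⌋ ∧ (rank F M ℕ.≡ᵇ t))
        no-codeword M h with Equivalence.to Bool.T-∧ h
        ... | C∋M , rank≡ᵇt = ℕ.<⇒≱ t<d (subst (d ≤_) rank≡t (proj₂ minDist M (toWitness C∋M) M≉0))
          where
            rank≡t = ℕ.≡ᵇ⇒≡ (rank F M) t rank≡ᵇt
            M≉0 : ¬ _≈M_ F M (0M F)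
            M≉0 M≈0 = ℕ.<⇒≢ 0<t (trans (sym (rank-0M M M≈0)) rank≡t)

theorem6p10 :
  ∀ {q : ℕ} (F : FiniteField q) (m n : ℕ) → 2 ≤ n → n ≤ m →
  (C : Mat F m n → Set) → IsLinearCode F C → (C? : ∀ M → Dec (C M)) →
  (d : ℕ) → IsMinRankDistance F C d →
  (∀ k → 𝒲ᴾ F C? d k
         ≡ ((Tmul (scalePoly (ℕ→ℚ (q ^ d)) (atScaled q (𝒲 F C? d)))
              ⊕ 𝒲 F C? d)
            ⊖ monomial ((ℕ→ℚ (W F C? n) ℚ.* ℕ→ℚ (q ^ n)) ÷ℕ (q ^ m ∸ 1))
                       (n ∸ d + 1)) k)
  ×
  (∀ k → 𝒲ˢ F C? d k
         ≡ (𝒲 F C? d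
            ⊖ monomial (ℕ→ℚ (W F C? n) ÷ℕ (q ^ m ∸ 1)) (n ∸ d)) k)
theorem6p10 F m zero () _ C code C? d minDist
theorem6p10 {q} F m (suc N) _ _ C code C? d minDist =
    normalize-𝒫 m N (WC F C?) (cong ℕ→ℚ (W-0 F code C? minDist))
                (λ t 0<t t<d → cong ℕ→ℚ (W-<d F code C? minDist t 0<t t<d)) 0<d d≤n
  , normalize-𝒮 m N (WC F C?) 0<d d≤n
  where
    open Normalization q
    0<d = minDistance-pos F code C? minDist
    d≤n = minDistance-≤ F code C? minDist
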